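{- Let $n\ge 2$ be a power of $2$, let $f\colon\{0,1\}^n\to\{0,1,*\}$ be a partial function and let $x\in f^{ -1}(*)$. Then there exists a total function $g\colon\{0,1\}^{N}\to\{0,1\}$ with $N\le 3n^2\log_2^2 n$ such that \[ \mathrm{C}_0(g)\;\ge\;\min\{\mathrm{C}_{\bar 0}(f,x),\,\mathrm{C}_{\bar 1}(f,x)\}\qquad\text{and}\qquad \mathrm{UC}_1(g)\;\le\;3\,\mathrm{C}(f)\log_2^2 n. \]
   Context: For a partial function $f\colon\{0,1\}^n\to\{0,1,*\}$ (inputs with value $*$ are "undefined"): a partial input $\rho\in\{0,1,*\}^n$ is consistent with $x\in\{0,1\}^n$ if $\rho_i=x_i$ whenever $\rho_i\neq *$; its size $|\rho|$ is the number of non-$*$ entries. For $\Sigma\subseteq\{0,1,*\}$, $\rho$ is a $\Sigma$-certificate for $x$ if $\rho$ is consistent with $x$ and $f(x')\in\Sigma$ for every $x'$ consistent with $\rho$. $\mathrm{C}_\Sigma(f,x)$ is the least size of a $\Sigma$-certificate for $x$, and $\mathrm{C}_\Sigma(f)=\max_{x\in f^{ -1}(\Sigma)}\mathrm{C}_\Sigma(f,x)$. We write $0,1,\bar0,\bar1$ for $\Sigma=\{0\},\{1\},\{1,*\},\{0,*\}$ respectively, and $\mathrm{C}(f)=\max\{\mathrm{C}_0(f),\mathrm{C}_1(f)\}$. For a total function $g$, $\mathrm{C}_0(g)$ equals the least $k$ such that $g$ is a width-$k$ CNF, and $\mathrm{UC}_1(g)$ is the least $k$ such that $g$ can be written as an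 unambiguous width-$k$ DNF (a DNF in which every input satisfies at most one term; width = maximum number of literals in a term). -}

module Defs where

open import Data.Bool using (Bool; true; false)
import Data.Bool.Properties as Bool
open import Data.Empty using (⊥-elim)
import Data.Fin as Fin
import Data.Fin.Properties as Fin
open import Data.List using (List; []; _∷_; _++_; map; filter; cartesianProductWith)
import Data.List.Extrema.Nat as Extrema
open import Data.List.Membership.Propositional using (_∈_; find; lose)
open import Data.List.Membership.Propositional.Properties
  using (∈-cartesianProductWith⁺; ∈-map⁺; ∈-map⁻; ∈-++⁺ˡ; ∈-++⁺ʳ; ∈-filter⁺; ∈-filter⁻)
import Data.List.Membership.DecPropositional as DecMembership
open import Data.List.Relation.Unary.All as All using (All)
open import Data.List.Relation.Unary.Any as Any using (Any; here; there)
open import Data.Maybe using (Maybe; just; nothing)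
import Data.Maybe.Properties as Maybe
open import Data.Nat using (ℕ; zero; suc; _≤_; z≤n; s≤s; _≤?_; _⊔_)
import Data.Nat.Properties as ℕ
open import Data.Product using (∃; ∃-syntax; _×_; _,_; proj₁; proj₂)
open import Data.Vec as Vec using (Vec; []; _∷_; lookup; count)
import Data.Vec.Properties as Vec
open import Function using (_∘_; _⇔_; mk⇔; module Equivalence)
open import Level using (Level)
open import Relation.Binary.Definitions using (DecidableEquality)
open import Relation.Binary.PropositionalEquality using (_≡_; _≢_; refl; sym; trans; cong₂; subst)
open import Relation.Nullary using (Dec; yes; no)
open import Relation.Nullary.Decidable using (map′; _×-dec_; _→-dec_; ¬?; does)
open import Relation.Unary using (Decidable)

private variable
  a p : Level
  A : Set a
  n : ℕ

least-from : {P : ℕ → Set p} → Decidable P → (m : ℕ) → P m →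
             ∃[ k ] P k × (∀ {j} → P j → k ≤ j)
least-from P? zero q = zero , q , λ _ → z≤n
least-from {P = P} P? (suc m) q with P? zero
... | yes q₀ = zero , q₀ , λ _ → z≤n
... | no ¬q₀ with least-from (P? ∘ suc) m q
...   | k , qk , k≤ = suc k , qk , minimal _
  where
  minimal : ∀ j → P j → suc k ≤ j
  minimal zero    q₀ = ⊥-elim (¬q₀ q₀)
  minimal (suc j) qj = s≤s (k≤ qj)

least : {P : ℕ → Set p} → Decidable P → ∃ P →
        ∃[ k ] P k × (∀ {j} → P j → k ≤ j)
least P? (m , q) = least-from P? m q

vecs : List A → ∀ n → List (Vec A n)
vecs xs zero    = [] ∷ []
vecs xs (suc n) = cartesianProductWith _∷_ xs (vecs xs n)

∈-vecs : {xs : List A} → (∀ y → y ∈ xs) → (v : Vec A n) → v ∈ vecs xs n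
∈-vecs ∈xs []      = here refl
∈-vecs ∈xs (y ∷ v) = ∈-cartesianProductWith⁺ _∷_ (∈xs y) (∈-vecs ∈xs v)

any-by : {P : A → Set p} (xs : List A) → (∀ y → y ∈ xs) → Decidable P → Dec (∃ P)
any-by xs ∈xs P? =
  map′ (λ q → let (y , _ , py) = find q in y , py) (λ (y , py) → lose (∈xs y) py) (Any.any? P? xs)

all-by : {P : A → Set p} (xs : List A) → (∀ y → y ∈ xs) → Decidable P → Dec (∀ y → P y)
all-by xs ∈xs P? =
  map′ (λ q y → All.lookup q (∈xs y)) (λ q → All.tabulate (λ {y} _ → q y)) (All.all? P? xs)

subsets : List A → List (List A)
subsets []       = [] ∷ []
subsets (x ∷ xs) = map (x ∷_) (subsets xs) ++ subsets xs

filter∈subsets : {P : A → Set p} (P? : Decidable P) (xs : List A) → filter P? xs ∈ subsets xs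
filter∈subsets P? []       = here refl
filter∈subsets P? (x ∷ xs) with does (P? x)
... | true  = ∈-++⁺ˡ (∈-map⁺ (x ∷_) (filter∈subsets P? xs))
... | false = ∈-++⁺ʳ (map (x ∷_) (subsets xs)) (filter∈subsets P? xs)

-- {0,1,*}, with * written ⋆ and standing for "undefined" as a function value and
-- for "unfixed" as an entry of a partial input.
Sym : Set
Sym = Maybe Bool

pattern ⋆ = nothing

Input : ℕ → Set
Input n = Vec Bool n

PartialInput : ℕ → Set
PartialInput n = Vec Sym n

PartialFn : ℕ → Set
PartialFn n = Input n → Sym

TotalFn : ℕ → Set
TotalFn n = Input n → Bool

toPartial : TotalFn n → PartialFn n
toPartial g x = just (g x)

_≟ˢ_ : DecidableEquality Sym
_≟ˢ_ = Maybe.≡-dec Bool._≟_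

∣_∣ : PartialInput n → ℕ
∣ ρ ∣ = count (λ s → ¬? (s ≟ˢ ⋆)) ρ

Consistent : PartialInput n → Input n → Set
Consistent ρ x = ∀ i → lookup ρ i ≢ ⋆ → lookup ρ i ≡ just (lookup x i)

consistent? : (ρ : PartialInput n) (x : Input n) → Dec (Consistent ρ x)
consistent? ρ x =
  Fin.all? (λ i → ¬? (lookup ρ i ≟ˢ ⋆) →-dec (lookup ρ i ≟ˢ just (lookup x i)))

bools : List Bool
bools = false ∷ true ∷ []

∈-bools : ∀ b → b ∈ bools
∈-bools false = here refl
∈-bools true  = there (here refl)

syms : List Sym
syms = ⋆ ∷ map just bools

∈-syms : ∀ s → s ∈ syms
∈-syms ⋆        = here refl
∈-syms (just b) = there (∈-map⁺ just (∈-bools b))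

inputs : ∀ n → List (Input n)
inputs = vecs bools

∈-inputs : (x : Input n) → x ∈ inputs n
∈-inputs = ∈-vecs ∈-bools

partialInputs : ∀ n → List (PartialInput n)
partialInputs = vecs syms

∈-partialInputs : (ρ : PartialInput n) → ρ ∈ partialInputs n
∈-partialInputs = ∈-vecs ∈-syms

full : Input n → PartialInput n
full = Vec.map just

full-consistent : (x : Input n) → Consistent (full x) x
full-consistent x i _ = Vec.lookup-map i just x

full-consistent⁻ : (x y : Input n) → Consistent (full x) y → x ≡ y
full-consistent⁻ []      []      c = refl
full-consistent⁻ (b ∷ x) (d ∷ y) c =
  cong₂ _∷_ (Maybe.just-injective (c Fin.zero λ ()))
            (full-consistent⁻ x y (λ i → c (Fin.suc i)))

-- Subsets of {0,1,*} are given by lists of their elements.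
Σ₀ Σ₁ Σ₀̄ Σ₁̄ : List Sym
Σ₀ = just false ∷ []
Σ₁ = just true ∷ []
Σ₀̄ = just true ∷ ⋆ ∷ []
Σ₁̄ = just false ∷ ⋆ ∷ []

_∈ˢ?_ : (s : Sym) (Σ : List Sym) → Dec (s ∈ Σ)
_∈ˢ?_ = DecMembership._∈?_ _≟ˢ_

IsCertificate : List Sym → PartialFn n → Input n → PartialInput n → Set
IsCertificate Σ f x ρ = Consistent ρ x × (∀ x′ → Consistent ρ x′ → f x′ ∈ Σ)

HasCertificateOfSize : List Sym → PartialFn n → Input n → ℕ → Set
HasCertificateOfSize Σ f x k = ∃[ ρ ] IsCertificate Σ f x ρ × ∣ ρ ∣ ≡ k

hasCertificateOfSize? : (Σ : List Sym) (f : PartialFn n) (x : Input n) →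
                        Decidable (HasCertificateOfSize Σ f x)
hasCertificateOfSize? {n} Σ f x k = any-by (partialInputs n) ∈-partialInputs λ ρ →
  (consistent? ρ x ×-dec
   all-by (inputs n) ∈-inputs (λ x′ → consistent? ρ x′ →-dec (f x′ ∈ˢ? Σ)))
  ×-dec (∣ ρ ∣ ℕ.≟ k)

someCertificate : (Σ : List Sym) (f : PartialFn n) (x : Input n) → f x ∈ Σ →
                  ∃ (HasCertificateOfSize Σ f x)
someCertificate Σ f x fx∈Σ =
  _ , full x ,
  (full-consistent x , λ x′ c → subst (λ y → f y ∈ Σ) (full-consistent⁻ x x′ c) fx∈Σ) , refl

-- A Σ-certificate for x exists exactly when f x ∈ Σ.
C-at : (Σ : List Sym) (f : PartialFn n) (x : Input n) → f x ∈ Σ → ℕ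
C-at Σ f x fx∈Σ = proj₁ (least (hasCertificateOfSize? Σ f x) (someCertificate Σ f x fx∈Σ))

-- Inputs outside f⁻¹(Σ) contribute 0 to the maximum; in particular it is 0 if
-- f⁻¹(Σ) is empty.
C-on : (Σ : List Sym) (f : PartialFn n) (x : Input n) → Dec (f x ∈ Σ) → ℕ
C-on Σ f x (yes fx∈Σ) = C-at Σ f x fx∈Σ
C-on Σ f x (no  _)    = 0

C[_] : List Sym → PartialFn n → ℕ
C[_] {n} Σ f = Extrema.max 0 (map (λ x → C-on Σ f x (f x ∈ˢ? Σ)) (inputs n))

C : PartialFn n → ℕ
C f = C[ Σ₀ ] f ⊔ C[ Σ₁ ] f

-- A term is identified with the partial input fixing the variables of its
-- literals, so that x satisfies the term iff x is consistent with it; its number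
-- of literals is ∣_∣.  A list of terms represents the set of its elements.
DNF : ℕ → Set
DNF n = List (PartialInput n)

Satisfies : Input n → DNF n → Set
Satisfies x D = Any (λ t → Consistent t x) D

Computes : DNF n → TotalFn n → Set
Computes D g = ∀ x → g x ≡ true ⇔ Satisfies x D

Unambiguous : DNF n → Set
Unambiguous D = ∀ x {s t} → s ∈ D → t ∈ D → Consistent s x → Consistent t x → s ≡ t

Width≤ : ℕ → DNF n → Set
Width≤ k D = All (λ t → ∣ t ∣ ≤ k) D

IsUnambiguousDNF : TotalFn n → ℕ → DNF n → Set
IsUnambiguousDNF g k D = Computes D g × Unambiguous D × Width≤ k D

HasUnambiguousDNF : TotalFn n → ℕ → Set
HasUnambiguousDNF g k = ∃ (IsUnambiguousDNF g k)

private
  _≟ᵖ_ : DecidableEquality (PartialInput n)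
  _≟ᵖ_ = Vec.≡-dec _≟ˢ_

  _∈ᵖ?_ : (t : PartialInput n) (D : DNF n) → Dec (t ∈ D)
  _∈ᵖ?_ = DecMembership._∈?_ _≟ᵖ_

  computes? : (D : DNF n) (g : TotalFn n) → Dec (Computes D g)
  computes? {n} D g = all-by (inputs n) ∈-inputs λ x →
    map′ (λ (l , r) → mk⇔ l r) (λ e → Equivalence.to e , Equivalence.from e)
      ((g x Bool.≟ true →-dec sat? x) ×-dec (sat? x →-dec g x Bool.≟ true))
    where
    sat? : ∀ x → Dec (Satisfies x D)
    sat? x = Any.any? (λ t → consistent? t x) D

  unambiguous? : (D : DNF n) → Dec (Unambiguous D)
  unambiguous? {n} D =
    map′ (λ q x s∈ t∈ → All.lookup (All.lookup (q x) s∈) t∈)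
         (λ q x → All.tabulate λ s∈ → All.tabulate λ t∈ → q x s∈ t∈)
      (all-by (inputs n) ∈-inputs λ x → All.all? (λ s → All.all? (λ t →
        consistent? s x →-dec consistent? t x →-dec (s ≟ᵖ t)) D) D)

  isUnambiguousDNF? : (g : TotalFn n) (k : ℕ) → Decidable (IsUnambiguousDNF g k)
  isUnambiguousDNF? g k D =
    computes? D g ×-dec unambiguous? D ×-dec All.all? (λ t → ∣ t ∣ ≤? k) D

  normalise : DNF n → DNF n
  normalise {n} D = filter (_∈ᵖ? D) (partialInputs n)

  normalise⁺ : (D : DNF n) → ∀ {t} → t ∈ D → t ∈ normalise D
  normalise⁺ D {t} = ∈-filter⁺ (_∈ᵖ? D) (∈-partialInputs t)

  normalise⁻ : (D : DNF n) → ∀ {t} → t ∈ normalise D → t ∈ D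
  normalise⁻ {n} D t∈ = proj₂ (∈-filter⁻ (_∈ᵖ? D) {xs = partialInputs n} t∈)

  normalise-isUnambiguousDNF : (g : TotalFn n) (k : ℕ) (D : DNF n) →
    IsUnambiguousDNF g k D → IsUnambiguousDNF g k (normalise D)
  normalise-isUnambiguousDNF g k D (comp , unamb , width) =
    (λ x → mk⇔
      (λ e → let (_ , t∈ , c) = find (Equivalence.to (comp x) e) in lose (normalise⁺ D t∈) c)
      (λ s → let (_ , t∈ , c) = find s in Equivalence.from (comp x) (lose (normalise⁻ D t∈) c))) ,
    (λ x s∈ t∈ → unamb x (normalise⁻ D s∈) (normalise⁻ D t∈)) ,
    All.tabulate (λ t∈ → All.lookup width (normalise⁻ D t∈))

hasUnambiguousDNF? : (g : TotalFn n) → Decidable (HasUnambiguousDNF g)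
hasUnambiguousDNF? {n} g k =
  map′ (λ q → let (D , _ , w) = find q in D , w)
       (λ (D , w) → lose (filter∈subsets (_∈ᵖ? D) (partialInputs n))
                         (normalise-isUnambiguousDNF g k D w))
    (Any.any? (isUnambiguousDNF? g k) (subsets (partialInputs n)))

someUnambiguousDNF : (g : TotalFn n) → ∃ (HasUnambiguousDNF g)
someUnambiguousDNF {n} g =
  n , D , comp , unamb , All.tabulate (λ {t} _ → Vec.count≤n (λ s → ¬? (s ≟ˢ ⋆)) t)
  where
  g⁻¹1 : List (Input n)
  g⁻¹1 = filter (λ x → g x Bool.≟ true) (inputs n)

  D : DNF n
  D = map full g⁻¹1

  minterm : ∀ {t} x → t ∈ D → Consistent t x → g x ≡ true × t ≡ full x
  minterm x t∈ c with ∈-map⁻ full t∈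
  ... | y , y∈ , refl with full-consistent⁻ y x c
  ...   | refl = proj₂ (∈-filter⁻ (λ z → g z Bool.≟ true) {xs = inputs n} y∈) , refl

  comp : Computes D g
  comp x = mk⇔
    (λ e → lose (∈-map⁺ full (∈-filter⁺ (λ z → g z Bool.≟ true) (∈-inputs x) e)) (full-consistent x))
    (λ s → let (_ , t∈ , c) = find s in proj₁ (minterm x t∈ c))

  unamb : Unambiguous D
  unamb x s∈ t∈ cs ct = trans (proj₂ (minterm x s∈ cs)) (sym (proj₂ (minterm x t∈ ct)))

UC₁ : TotalFn n → ℕ
UC₁ g = proj₁ (least (hasUnambiguousDNF? g) (someUnambiguousDNF g))

{-# OPTIONS --safe #-}

-- A cheat sheet construction.  Let n = 2^m.  An input of g consists of m copies of an
-- input of f and of n cells, one for every a ∈ {0,1}^m, each holding C(f) pointers of m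
-- bits for every copy.  g is 1 iff, for some a, the positions of the i-th copy that cell a
-- points to certify f = aᵢ for all i.  This a is then determined by the values of f on the
-- copies, so reading cell a and the positions it points to gives an unambiguous term.
-- Conversely, if all copies equal x, then g is 0; a partial input certifying this that
-- leaves some cell a untouched must certify f ≠ aᵢ on some copy i, for otherwise the copies
-- could be completed to have values a and certificates for them could be written in cell a.
-- If no cell is untouched, its size is at least n.
module Submission where

open import Defs
open import Data.Bool using (Bool; true; false; if_then_else_)
import Data.Bool.Properties as Bool
open import Data.Fin using (Fin; zero; suc; combine; remQuot)
import Data.Fin.Properties as Fin
open import Data.List as List using (List; []; _∷_; _++_; length)
open import Data.List.Extrema.Nat using (xs≤max; max≤v⁺)
open import Data.List.Membership.Propositional using (_∈_; find; lose)
open import Data.List.Membership.Propositional.Properties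
  using (∈-map⁺; ∈-map⁻; ∈-filter⁺; ∈-filter⁻; ∈-++⁺ˡ; ∈-++⁺ʳ; ∈-tabulate⁺)
import Data.List.Properties as List
open import Data.List.Relation.Unary.All as All using (All)
import Data.List.Relation.Unary.All.Properties as All
open import Data.List.Relation.Unary.Any using (here; there)
open import Data.Maybe using (just; fromMaybe)
import Data.Maybe.Properties as Maybe
open import Data.Nat using (ℕ; NonZero; zero; suc; _≤_; _<_; _≥_; _+_; _*_; _^_; _⊓_; z≤n; s≤s)
open import Data.Nat.Logarithm using (⌊log₂_⌋; ⌊log₂[2^n]⌋≡n)
import Data.Nat.Properties as ℕ
open import Data.Nat.Solver using (module +-*-Solver)
open import Data.Product using (∃-syntax; Σ-syntax; _×_; _,_; proj₁; proj₂)
open import Data.Product.Function.NonDependent.Propositional using (_×-↔_)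
open import Data.Sum using (_⊎_; inj₁; inj₂)
open import Data.Sum.Properties using (inj₂-injective)
open import Data.Sum.Function.Propositional using (_⊎-↔_)
open import Data.Vec as Vec using (Vec; []; _∷_; lookup; tabulate; replicate; _[_]≔_)
import Data.Vec.Properties as Vec
open import Function using (_∘_; mk⇔; _↔_; Inverse; Injective)
open import Function.Construct.Composition using (_↔-∘_)
open import Function.Construct.Identity using (↔-id)
open import Relation.Binary.PropositionalEquality
  using (_≡_; _≢_; refl; sym; trans; cong; cong₂; subst)
open import Relation.Nullary using (Dec; yes; no; ¬_; contradiction)
open import Relation.Nullary.Decidable
  using (does; ¬?; decidable-stable; dec-true; dec-false; _→-dec_; _×-dec_)

private variable
  n k m : ℕ

-- Sizes of partial inputs

∣replicate-⋆∣ : ∀ n → ∣ replicate n ⋆ ∣ ≡ 0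
∣replicate-⋆∣ zero    = refl
∣replicate-⋆∣ (suc n) = ∣replicate-⋆∣ n

∣∷∣≤ : ∀ s (ρ : PartialInput n) → ∣ s ∷ ρ ∣ ≤ suc ∣ ρ ∣
∣∷∣≤ ⋆        ρ = ℕ.n≤1+n _
∣∷∣≤ (just _) ρ = ℕ.≤-refl

≤∣∷∣ : ∀ s (ρ : PartialInput n) → ∣ ρ ∣ ≤ ∣ s ∷ ρ ∣
≤∣∷∣ ⋆        ρ = ℕ.≤-refl
≤∣∷∣ (just _) ρ = ℕ.n≤1+n _

∣[]≔∣≤ : ∀ (ρ : PartialInput n) i s → ∣ ρ [ i ]≔ s ∣ ≤ suc ∣ ρ ∣
∣[]≔∣≤ (t ∷ ρ)      zero    s = ℕ.≤-trans (∣∷∣≤ s ρ) (s≤s (≤∣∷∣ t ρ))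
∣[]≔∣≤ (⋆ ∷ ρ)      (suc i) s = ∣[]≔∣≤ ρ i s
∣[]≔∣≤ (just _ ∷ ρ) (suc i) s = s≤s (∣[]≔∣≤ ρ i s)

∣unset∣ : ∀ (ρ : PartialInput n) i → lookup ρ i ≢ ⋆ → suc ∣ ρ [ i ]≔ ⋆ ∣ ≡ ∣ ρ ∣
∣unset∣ (⋆ ∷ ρ)      zero    set = contradiction refl set
∣unset∣ (just _ ∷ ρ) zero    set = refl
∣unset∣ (⋆ ∷ ρ)      (suc i) set = ∣unset∣ ρ i set
∣unset∣ (just _ ∷ ρ) (suc i) set = cong suc (∣unset∣ ρ i set)

∣total∣ : (ρ : PartialInput n) → (∀ i → lookup ρ i ≢ ⋆) → n ≤ ∣ ρ ∣
∣total∣ []           set = z≤n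
∣total∣ (⋆ ∷ ρ)      set = contradiction refl (set zero)
∣total∣ (just _ ∷ ρ) set = s≤s (∣total∣ ρ (set ∘ suc))

∣∣≤n : (ρ : PartialInput n) → ∣ ρ ∣ ≤ n
∣∣≤n = Vec.count≤n _

pullback : (Fin k → Fin n) → PartialInput n → PartialInput k
pullback φ ρ = tabulate (lookup ρ ∘ φ)

-- Induction on `k`: once the entry at `φ zero` is counted, it can be unset in `ρ`. By injectivity
-- the rest of the pullback does not see this, while `ρ` loses exactly one set entry.
∣pullback∣≤ : (φ : Fin k → Fin n) → Injective _≡_ _≡_ φ → (ρ : PartialInput n) →
              ∣ pullback φ ρ ∣ ≤ ∣ ρ ∣
∣pullback∣≤ {zero}  φ inj ρ = z≤n
∣pullback∣≤ {suc k} φ inj ρ with lookup ρ (φ zero) in eq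
... | ⋆      = ∣pullback∣≤ (φ ∘ suc) (Fin.suc-injective ∘ inj) ρ
... | just b = begin
  suc ∣ pullback (φ ∘ suc) ρ ∣                   ≡⟨ cong (λ ρ′ → suc ∣ ρ′ ∣) (Vec.tabulate-cong unchanged) ⟩
  suc ∣ pullback (φ ∘ suc) (ρ [ φ zero ]≔ ⋆) ∣   ≤⟨ s≤s (∣pullback∣≤ (φ ∘ suc) (Fin.suc-injective ∘ inj) (ρ [ φ zero ]≔ ⋆)) ⟩
  suc ∣ ρ [ φ zero ]≔ ⋆ ∣                        ≡⟨ ∣unset∣ ρ (φ zero) (λ e → contradiction (trans (sym eq) e) λ ()) ⟩
  ∣ ρ ∣                                          ∎
  where
  open ℕ.≤-Reasoning
  unchanged : ∀ j → lookup ρ (φ (suc j)) ≡ lookup (ρ [ φ zero ]≔ ⋆) (φ (suc j))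
  unchanged j = sym (Vec.lookup∘update′ (λ e → contradiction (inj e) λ ()) ρ ⋆)

-- Serves to count one set variable per cell.
set-injectively : (φ : Fin k → Fin n) → Injective _≡_ _≡_ φ → (ρ : PartialInput n) →
                  (∀ j → lookup ρ (φ j) ≢ ⋆) → k ≤ ∣ ρ ∣
set-injectively φ inj ρ set = ℕ.≤-trans
  (∣total∣ (pullback φ ρ) (λ j → set j ∘ trans (sym (Vec.lookup∘tabulate _ j))))
  (∣pullback∣≤ φ inj ρ)

-- Fewer than k positions may be set; the remaining values of the enumeration are arbitrary.
enumerate-set : (ρ : PartialInput n) → Fin n → ∣ ρ ∣ ≤ k →
                Σ[ p ∈ (Fin k → Fin n) ] ∀ j → lookup ρ j ≢ ⋆ → ∃[ c ] p c ≡ j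
enumerate-set {k = k} ρ o ∣ρ∣≤k with Fin.all? (λ j → lookup ρ j ≟ˢ ⋆)
... | yes unset = (λ _ → o) , λ j set → contradiction (unset j) set
... | no ¬unset with Fin.¬∀⟶∃¬ _ _ (λ j → lookup ρ j ≟ˢ ⋆) ¬unset
enumerate-set {k = zero}  ρ o ∣ρ∣≤k | no _ | i , set =
  contradiction (subst (_≤ 0) (sym (∣unset∣ ρ i set)) ∣ρ∣≤k) λ ()
enumerate-set {k = suc k} ρ o ∣ρ∣≤k | no _ | i , set
  with p , covers ← enumerate-set {k = k} (ρ [ i ]≔ ⋆) o
                      (ℕ.≤-pred (subst (_≤ suc k) (sym (∣unset∣ ρ i set)) ∣ρ∣≤k))
  = (λ { zero → i ; (suc c) → p c }) , covers′
  where
  covers′ : ∀ j → lookup ρ j ≢ ⋆ → ∃[ c ] _ ≡ j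
  covers′ j setⱼ with i Fin.≟ j
  ... | yes i≡j = zero , i≡j
  ... | no  i≢j =
    let c , pc≡j = covers j (setⱼ ∘ trans (sym (Vec.lookup∘update′ (i≢j ∘ sym) ρ ⋆)))
    in suc c , pc≡j

-- Restrictions to queried positions and unambiguous DNFs

restrict : Input n → List (Fin n) → PartialInput n
restrict z []      = replicate _ ⋆
restrict z (i ∷ L) = restrict z L [ i ]≔ just (lookup z i)

-- An inequality, because positions may repeat in `L`.
∣restrict∣≤length : (z : Input n) (L : List (Fin n)) → ∣ restrict z L ∣ ≤ length L
∣restrict∣≤length {n} z [] = ℕ.≤-reflexive (∣replicate-⋆∣ n)
∣restrict∣≤length z (i ∷ L) =
  ℕ.≤-trans (∣[]≔∣≤ (restrict z L) i _) (s≤s (∣restrict∣≤length z L))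

restrict-cong : {z x : Input n} (L : List (Fin n)) →
                (∀ {i} → i ∈ L → lookup z i ≡ lookup x i) → restrict z L ≡ restrict x L
restrict-cong []      z≡x = refl
restrict-cong (i ∷ L) z≡x =
  cong₂ (λ ρ b → ρ [ i ]≔ just b) (restrict-cong L (z≡x ∘ there)) (z≡x (here refl))

lookup-restrict : (z : Input n) {L : List (Fin n)} {i : Fin n} → i ∈ L →
                  lookup (restrict z L) i ≡ just (lookup z i)
lookup-restrict z {j ∷ L} {i} i∈ with i Fin.≟ j
lookup-restrict z {j ∷ L} _           | yes refl = Vec.lookup∘update j (restrict z L) _
lookup-restrict z {j ∷ L} (here i≡j)  | no i≢j = contradiction i≡j i≢j
lookup-restrict z {j ∷ L} (there i∈L) | no i≢j =
  trans (Vec.lookup∘update′ i≢j (restrict z L) _) (lookup-restrict z i∈L)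

restrict-consistent : (z : Input n) (L : List (Fin n)) → Consistent (restrict z L) z
restrict-consistent z []      i set = contradiction (Vec.lookup-replicate i ⋆) set
restrict-consistent z (j ∷ L) i set with i Fin.≟ j
... | yes refl = Vec.lookup∘update j (restrict z L) _
... | no i≢j   = trans unchanged (restrict-consistent z L i (set ∘ trans unchanged))
  where unchanged = Vec.lookup∘update′ i≢j (restrict z L) _

consistent-agree : {z x : Input n} {L : List (Fin n)} → Consistent (restrict z L) x →
                   ∀ {i} → i ∈ L → lookup z i ≡ lookup x i
consistent-agree {z = z} c {i} i∈L = Maybe.just-injective (trans (sym e)
  (c i (λ e⋆ → contradiction (trans (sym e) e⋆) λ ())))
  where e = lookup-restrict z i∈L

-- The terms are the restrictions of the 1-inputs of g to the positions queried on them.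
unambiguousDNF : (g : TotalFn n) (query : Input n → List (Fin n)) →
  (∀ {z x} → g z ≡ true → (∀ {i} → i ∈ query z → lookup z i ≡ lookup x i) →
    g x ≡ true × query x ≡ query z) →
  (∀ z → length (query z) ≤ k) → HasUnambiguousDNF g k
unambiguousDNF {n} {k} g query determined short = D , computes , unambiguous , width
  where
  term : Input n → PartialInput n
  term z = restrict z (query z)

  1-inputs : List (Input n)
  1-inputs = List.filter (λ z → g z Bool.≟ true) (inputs n)

  D : DNF n
  D = List.map term 1-inputs

  satisfied : ∀ {t} x → t ∈ D → Consistent t x → g x ≡ true × t ≡ term x
  -- If `x` satisfies the term of `z`, both have the same query and agree on it, so that term is the
  -- term of `x`. Unambiguity follows, since the term depends on `x` alone.
  satisfied x t∈D c with z , z∈ , refl ← ∈-map⁻ term t∈D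
    with agree ← consistent-agree {z = z} {x} {query z} c
    with gx , same ← determined (proj₂ (∈-filter⁻ (λ z → g z Bool.≟ true) {xs = inputs n} z∈)) agree
    = gx , trans (restrict-cong (query z) agree) (cong (restrict x) (sym same))

  computes : Computes D g
  computes x = mk⇔
    (λ gx → lose (∈-map⁺ term (∈-filter⁺ (λ z → g z Bool.≟ true) (∈-inputs x) gx))
                 (restrict-consistent x (query x)))
    (λ s → let _ , t∈D , c = find s in proj₁ (satisfied x t∈D c))

  unambiguous : Unambiguous D
  unambiguous x s∈D t∈D cs ct =
    trans (proj₂ (satisfied x s∈D cs)) (sym (proj₂ (satisfied x t∈D ct)))

  width : Width≤ k D
  width = All.map⁺ (All.tabulate λ {z} _ → ℕ.≤-trans (∣restrict∣≤length z (query z)) (short z))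

-- Minimality and existence of certificates

UC₁≤ : (g : TotalFn n) → HasUnambiguousDNF g k → UC₁ g ≤ k
UC₁≤ g = proj₂ (proj₂ (least (hasUnambiguousDNF? g) (someUnambiguousDNF g)))

C-at≤ : ∀ Σ (f : PartialFn n) x fx∈Σ {ρ} → IsCertificate Σ f x ρ → C-at Σ f x fx∈Σ ≤ ∣ ρ ∣
C-at≤ Σ f x fx∈Σ {ρ} cert =
  proj₂ (proj₂ (least (hasCertificateOfSize? Σ f x) (someCertificate Σ f x fx∈Σ))) (ρ , cert , refl)

C-at-certificate : ∀ Σ (f : PartialFn n) x fx∈Σ → HasCertificateOfSize Σ f x (C-at Σ f x fx∈Σ)
C-at-certificate Σ f x fx∈Σ =
  proj₁ (proj₂ (least (hasCertificateOfSize? Σ f x) (someCertificate Σ f x fx∈Σ)))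

C-at≤n : ∀ Σ (f : PartialFn n) x fx∈Σ → C-at Σ f x fx∈Σ ≤ n
C-at≤n Σ f x fx∈Σ =
  let ρ , _ , ∣ρ∣≡ = C-at-certificate Σ f x fx∈Σ in subst (_≤ _) ∣ρ∣≡ (∣∣≤n ρ)

C-on≤n : ∀ Σ (f : PartialFn n) x d → C-on Σ f x d ≤ n
C-on≤n Σ f x (yes fx∈Σ) = C-at≤n Σ f x fx∈Σ
C-on≤n Σ f x (no _)     = z≤n

C[]≤n : ∀ Σ (f : PartialFn n) → C[ Σ ] f ≤ n
C[]≤n {n} Σ f = max≤v⁺ {xs = List.map _ (inputs n)} z≤n
  (All.map⁺ (All.tabulate λ {x} _ → C-on≤n Σ f x (f x ∈ˢ? Σ)))

C-on-certificate : ∀ Σ (f : PartialFn n) x d → f x ∈ Σ → HasCertificateOfSize Σ f x (C-on Σ f x d)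
C-on-certificate Σ f x (yes fx∈Σ) _    = C-at-certificate Σ f x fx∈Σ
C-on-certificate Σ f x (no fx∉Σ)  fx∈Σ = contradiction fx∈Σ fx∉Σ

certificate≤C[] : ∀ Σ (f : PartialFn n) x → f x ∈ Σ →
                  ∃[ ρ ] IsCertificate Σ f x ρ × ∣ ρ ∣ ≤ C[ Σ ] f
certificate≤C[] {n} Σ f x fx∈Σ =
  let ρ , cert , ∣ρ∣≡ = C-on-certificate Σ f x (f x ∈ˢ? Σ) fx∈Σ
  in ρ , cert , subst (_≤ C[ Σ ] f) (sym ∣ρ∣≡)
       (All.lookup (xs≤max 0 (List.map (λ x → C-on Σ f x (f x ∈ˢ? Σ)) (inputs n)))
         (∈-map⁺ (λ x → C-on Σ f x (f x ∈ˢ? Σ)) (∈-inputs x)))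

-- Binary addresses and lists of images

from-does : {P : Set} (P? : Dec P) → does P? ≡ true → P
from-does (yes p) _ = p

toBits : ∀ m → Fin (2 ^ m) → Vec Bool m
toBits zero    a = []
toBits (suc m) a = let q , r = remQuot (2 ^ m) a in Inverse.to Fin.2↔Bool q ∷ toBits m r

fromBits : Vec Bool m → Fin (2 ^ m)
fromBits []      = zero
fromBits (b ∷ v) = combine (Inverse.from Fin.2↔Bool b) (fromBits v)

fromBits-toBits : ∀ m a → fromBits (toBits m a) ≡ a
fromBits-toBits zero    zero = refl
fromBits-toBits (suc m) a    =
  let q , r = remQuot {2} (2 ^ m) a
  in trans (cong₂ combine (Inverse.strictlyInverseʳ Fin.2↔Bool q) (fromBits-toBits m r))
           (Fin.combine-remQuot {2} (2 ^ m) a)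

-- Repetitions are kept, so the length is exactly `k` even when pointers coincide.
image : {A : Set} → Fin k ↔ A → (A → Fin n) → List (Fin n)
image e h = List.tabulate (h ∘ Inverse.to e)

∈-image : {A : Set} (e : Fin k ↔ A) (h : A → Fin n) (x : A) → h x ∈ image e h
∈-image e h x = subst (λ y → h y ∈ image e h) (Inverse.strictlyInverseˡ e x)
  (∈-tabulate⁺ (Inverse.from e x))

length-image : {A : Set} (e : Fin k ↔ A) (h : A → Fin n) → length (image e h) ≡ k
length-image e h = List.length-tabulate (h ∘ Inverse.to e)

-- The cheat sheet function

module CheatSheet (m k : ℕ) (f : PartialFn (2 ^ m)) where

  Cell : Set
  Cell = Fin m × Fin k × Fin m

  -- Bit j of copy i of the input of f, or bit s of the cell at address a.
  Variable : Set
  Variable = (Fin m × Fin (2 ^ m)) ⊎ (Fin (2 ^ m) × Cell)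

  abstract
    cell↔ : Fin (m * (k * m)) ↔ Cell
    cell↔ = (↔-id _ ×-↔ Fin.*↔×) ↔-∘ Fin.*↔×

  arity : ℕ
  arity = m * 2 ^ m + 2 ^ m * (m * (k * m))

  abstract
    -- Kept opaque: the arguments below rest on the inverse laws, not on the order in which the
    -- variables are numbered.
    variable↔ : Fin arity ↔ Variable
    variable↔ = (Fin.*↔× ⊎-↔ ((↔-id _ ×-↔ cell↔) ↔-∘ Fin.*↔×)) ↔-∘ Fin.+↔⊎

  position : Variable → Fin arity
  position = Inverse.from variable↔

  position-injective : Injective _≡_ _≡_ position
  position-injective {u} {v} e = trans (sym (Inverse.strictlyInverseˡ variable↔ u))
    (trans (cong (Inverse.to variable↔) e) (Inverse.strictlyInverseˡ variable↔ v))

  value : Input arity → Variable → Bool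
  value z v = lookup z (position v)

  assemble : (Variable → Bool) → Input arity
  assemble h = tabulate (h ∘ Inverse.to variable↔)

  value-assemble : ∀ h v → value (assemble h) v ≡ h v
  value-assemble h v = trans (Vec.lookup∘tabulate _ (position v))
    (cong h (Inverse.strictlyInverseˡ variable↔ v))

  consistent-by-value : ∀ ρ z →
    (∀ v → lookup ρ (position v) ≢ ⋆ → lookup ρ (position v) ≡ just (value z v)) → Consistent ρ z
  consistent-by-value ρ z c i =
    subst (λ j → lookup ρ j ≢ ⋆ → lookup ρ j ≡ just (lookup z j))
      (Inverse.strictlyInverseʳ variable↔ i) (c (Inverse.to variable↔ i))

  copy : Input arity → Fin m → Input (2 ^ m)
  copy z i = tabulate (λ j → value z (inj₁ (i , j)))

  pointer : Input arity → Fin (2 ^ m) → Fin m → Fin k → Fin (2 ^ m)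
  pointer z a i c = fromBits (tabulate λ b → value z (inj₂ (a , i , c , b)))

  -- Says that `y` restricted to the range of `p` is a certificate for the value `b`. Repeated
  -- pointers are harmless, and `y′ = y` gives `f y ≡ just b`.
  CertifiedBy : (p : Fin k → Fin (2 ^ m)) → Input (2 ^ m) → Bool → Set
  CertifiedBy p y b = ∀ y′ → (∀ c → lookup y′ (p c) ≡ lookup y (p c)) → f y′ ≡ just b

  Valid : Input arity → Fin (2 ^ m) → Set
  Valid z a = ∀ i → CertifiedBy (pointer z a i) (copy z i) (lookup (toBits m a) i)

  valid? : ∀ z a → Dec (Valid z a)
  valid? z a = Fin.all? λ i → all-by (inputs _) ∈-inputs λ y →
    Fin.all? (λ c → lookup y (pointer z a i c) Bool.≟ lookup (copy z i) (pointer z a i c))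
      →-dec (f y ≟ˢ just (lookup (toBits m a) i))

  -- Undefined values of f give the junk bit false; no cell is valid in that case.
  address : Input arity → Fin (2 ^ m)
  address z = fromBits (tabulate λ i → fromMaybe false (f (copy z i)))

  -- Each certificate applies to the copy itself, so the bits of `a` are the values of `f` on the
  -- copies. Hence at most one cell is valid.
  address-valid : ∀ {z a} → Valid z a → address z ≡ a
  address-valid {z} {a} valid = trans
    (cong fromBits (trans
      (Vec.tabulate-cong λ i → cong (fromMaybe false) (valid i (copy z i) λ _ → refl))
      (Vec.tabulate∘lookup (toBits m a))))
    (fromBits-toBits m a)

  -- Testing the cell at `address z` decides whether any cell is valid, by `address-valid`.
  g : TotalFn arity
  g z = does (valid? z (address z))

  g⁺ : ∀ {z a} → Valid z a → g z ≡ true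
  g⁺ {z} {a} valid = dec-true (valid? z (address z))
    (subst (Valid z) (sym (address-valid {z} {a} valid)) valid)

  g⁻ : ∀ {z} → g z ≡ true → Valid z (address z)
  g⁻ {z} = from-does (valid? z (address z))

  -- Upper bound on the unambiguous DNF width

  cellVariable : Fin (2 ^ m) → Cell → Fin arity
  cellVariable a s = position (inj₂ (a , s))

  pointedVariable : (Fin m → Fin k → Fin (2 ^ m)) → Fin m × Fin k → Fin arity
  pointedVariable p (i , c) = position (inj₁ (i , p i c))

  query : Input arity → Fin (2 ^ m) → List (Fin arity)
  query z a = image cell↔ (cellVariable a) ++ image Fin.*↔× (pointedVariable (pointer z a))

  length-query : ∀ z a → length (query z a) ≡ m * (k * m) + m * k
  length-query z a = trans (List.length-++ (image cell↔ (cellVariable a)))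
    (cong₂ _+_ (length-image cell↔ (cellVariable a))
               (length-image Fin.*↔× (pointedVariable (pointer z a))))

  -- Agreement on cell `a` makes the pointers equal, hence also the queries. Agreement on the
  -- pointed positions then carries the certificates over from `z` to `x`.
  query-determines : ∀ {z x} a → (∀ {i} → i ∈ query z a → lookup z i ≡ lookup x i) → Valid z a →
                     Valid x a × query x a ≡ query z a
  query-determines {z} {x} a agree valid = valid-x ,
    cong (image cell↔ (cellVariable a) ++_) (List.tabulate-cong λ r →
      let i , c = Inverse.to (Fin.*↔× {m} {k}) r
      in cong (λ p → position (inj₁ (i , p))) (sym (pointer≡ i c)))
    where
    pointer≡ : ∀ i c → pointer z a i c ≡ pointer x a i c
    pointer≡ i c = cong fromBits (Vec.tabulate-cong λ b →
      agree (∈-++⁺ˡ (∈-image cell↔ (cellVariable a) (i , c , b))))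

    copy≡ : ∀ i c → lookup (copy z i) (pointer z a i c) ≡ lookup (copy x i) (pointer z a i c)
    copy≡ i c = trans (Vec.lookup∘tabulate _ (pointer z a i c)) (trans
      (agree (∈-++⁺ʳ (image cell↔ (cellVariable a))
        (∈-image Fin.*↔× (pointedVariable (pointer z a)) (i , c))))
      (sym (Vec.lookup∘tabulate _ (pointer z a i c))))

    valid-x : Valid x a
    valid-x i y h = valid i y λ c → trans
      (subst (λ p → lookup y p ≡ lookup (copy x i) p) (sym (pointer≡ i c)) (h c))
      (sym (copy≡ i c))

  UC₁-g≤ : UC₁ g ≤ m * (k * m) + m * k
  UC₁-g≤ = UC₁≤ {arity} {m * (k * m) + m * k} g
    (unambiguousDNF g (λ z → query z (address z)) (λ {z} {x} → determined {z} {x})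
      (λ z → ℕ.≤-reflexive (length-query z (address z))))
    where
    determined : ∀ {z x} → g z ≡ true → (∀ {i} → i ∈ query z (address z) → lookup z i ≡ lookup x i) →
                 g x ≡ true × query x (address x) ≡ query z (address z)
    determined {z} {x} gz agree =
      let valid , same = query-determines {z} {x} (address z) agree (g⁻ {z} gz)
      in g⁺ {x} {address z} valid ,
         trans (cong (query x) (address-valid {x} {address z} valid)) same

  -- Lower bound on the 0-certificate complexity

  copyᵖ : PartialInput arity → Fin m → PartialInput (2 ^ m)
  copyᵖ ρ i = pullback (λ j → position (inj₁ (i , j))) ρ

  lookup-copyᵖ : ∀ ρ i j → lookup (copyᵖ ρ i) j ≡ lookup ρ (position (inj₁ (i , j)))
  lookup-copyᵖ ρ i j = Vec.lookup∘tabulate _ j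

  ∣copyᵖ∣≤ : ∀ ρ i → ∣ copyᵖ ρ i ∣ ≤ ∣ ρ ∣
  ∣copyᵖ∣≤ ρ i = ∣pullback∣≤ (λ j → position (inj₁ (i , j))) inj ρ
    where
    inj : Injective _≡_ _≡_ (λ j → position (inj₁ (i , j)))
    inj {j} {j′} e with refl ← position-injective {inj₁ (i , j)} {inj₁ (i , j′)} e = refl

  Untouched : PartialInput arity → Fin (2 ^ m) → Set
  Untouched ρ a = ∀ s → lookup ρ (cellVariable a s) ≡ ⋆

  -- The cell bits are an arbitrary choice; the copies alone force `g` to be 0.
  uniformValue : Input (2 ^ m) → Variable → Bool
  uniformValue x (inj₁ (i , j)) = lookup x j
  uniformValue x (inj₂ _)       = false

  uniform : Input (2 ^ m) → Input arity
  uniform x = assemble (uniformValue x)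

  copy-assemble : ∀ h i x → (∀ j → h (inj₁ (i , j)) ≡ lookup x j) → copy (assemble h) i ≡ x
  copy-assemble h i x e =
    trans (Vec.tabulate-cong λ j → trans (value-assemble h _) (e j)) (Vec.tabulate∘lookup x)

  -- A valid cell would certify a value of `f` on copy `i`, which is `x`. The index provides such a
  -- copy: for `m = 0` every cell is vacuously valid.
  g-uniform : Fin m → ∀ x → f x ≡ ⋆ → g (uniform x) ≡ false
  g-uniform i x fx≡⋆ = dec-false (valid? z (address z)) λ valid →
    ⋆≢just (trans (sym fx≡⋆) (trans (cong f (sym copy≡x)) (valid i (copy z i) λ _ → refl)))
    where
    z : Input arity
    z = uniform x
    copy≡x : copy z i ≡ x
    copy≡x = copy-assemble (uniformValue x) i x λ _ → refl
    ⋆≢just : ∀ {b : Bool} → ¬ (⋆ ≡ just b)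
    ⋆≢just ()

  -- The copies become the completions `y i`, and the free cell `a` is filled with the pointers `p`,
  -- which makes it valid.
  forge : ∀ x ρ a → Consistent ρ (uniform x) → Untouched ρ a →
    (y : Fin m → Input (2 ^ m)) → (∀ i → Consistent (copyᵖ ρ i) (y i)) →
    (p : Fin m → Fin k → Fin (2 ^ m)) →
    (∀ i → CertifiedBy (p i) (y i) (lookup (toBits m a) i)) →
    ∃[ z ] Consistent ρ z × g z ≡ true
  forge x ρ a ρ∼x untouched y ρ∼y p certified = z , consistent-by-value ρ z ρ∼z , g⁺ {z} {a} valid
    where
    cell : Cell → Bool
    cell (i , c , b) = lookup (toBits m (p i c)) b

    h : Variable → Bool
    h (inj₁ (i , j))  = lookup (y i) j
    -- The other cells keep their bits from `uniform x`, with which `ρ` is consistent.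
    h (inj₂ (a′ , s)) = if does (a′ Fin.≟ a) then cell s else false

    z : Input arity
    z = assemble h

    ρ∼z : ∀ v → lookup ρ (position v) ≢ ⋆ → lookup ρ (position v) ≡ just (value z v)
    ρ∼z v set = trans (agrees v set) (cong just (sym (value-assemble h v)))
      where
      agrees : ∀ v → lookup ρ (position v) ≢ ⋆ → lookup ρ (position v) ≡ just (h v)
      agrees (inj₁ (i , j)) set =
        let e = lookup-copyᵖ ρ i j in trans (sym e) (ρ∼y i j (set ∘ trans (sym e)))
      agrees (inj₂ (a′ , s)) set with a′ Fin.≟ a
      ... | yes refl = contradiction (untouched s) set
      ... | no  _    = trans (ρ∼x _ set) (cong just (value-assemble (uniformValue x) (inj₂ (a′ , s))))

    pointer-z : ∀ i c → pointer z a i c ≡ p i c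
    pointer-z i c = trans
      (cong fromBits (trans (Vec.tabulate-cong λ b → trans (value-assemble h (inj₂ (a , i , c , b)))
          (cong (λ t → if t then cell (i , c , b) else false) (dec-true (a Fin.≟ a) refl)))
        (Vec.tabulate∘lookup (toBits m (p i c)))))
      (fromBits-toBits m (p i c))

    valid : Valid z a
    valid i y′ e = certified i y′ λ c →
      subst (λ q → lookup y′ q ≡ lookup (y i) q) (pointer-z i c)
        (trans (e c) (cong (λ u → lookup u (pointer z a i c)) (copy-assemble h i (y i) λ _ → refl)))

  -- The link between the free parameter `k` and `f`; it will hold for `k = C f`.
  SmallCertificates : Set
  SmallCertificates = ∀ {y b} → f y ≡ just b → ∃[ ρ ] IsCertificate (just b ∷ []) f y ρ × ∣ ρ ∣ ≤ k

  -- The set positions of a small certificate fit among `k` pointers, and surplus pointers only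
  -- constrain `y′` further. The `Fin (2 ^ m)` argument is a default target for them.
  certifiedBy : SmallCertificates →
    Fin (2 ^ m) → ∀ {y b} → f y ≡ just b → ∃[ p ] CertifiedBy p y b
  certifiedBy small o {y} {b} fy with ρ , (ρ∼y , cert) , ∣ρ∣≤k ← small fy
    with p , covers ← enumerate-set ρ o ∣ρ∣≤k = p , λ y′ e → singleton (cert y′ λ j set →
      let c , pc≡j = covers j set
      in trans (ρ∼y j set) (cong just (sym (subst (λ i → lookup y′ i ≡ lookup y i) pc≡j (e c)))))
    where
    singleton : ∀ {s} → s ∈ just b ∷ [] → s ≡ just b
    singleton (here e) = e

  C-min : ∀ x → f x ≡ ⋆ → ℕ
  C-min x fx≡⋆ = C-at Σ₀̄ f x (there (here fx≡⋆)) ⊓ C-at Σ₁̄ f x (there (here fx≡⋆))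

  -- Excluding the value `b` leaves the other bit and `⋆`, so `ρ` is a certificate of one of the two
  -- kinds in the minimum.
  C-min≤ : ∀ x (fx≡⋆ : f x ≡ ⋆) b ρ → Consistent ρ x →
    (∀ y → Consistent ρ y → f y ≢ just b) →
    C-min x fx≡⋆ ≤ ∣ ρ ∣
  C-min≤ x fx≡⋆ false ρ ρ∼x avoids =
    ℕ.≤-trans (ℕ.m⊓n≤m _ _) (C-at≤ Σ₀̄ f x _ {ρ} (ρ∼x , λ y ρ∼y → member (f y) (avoids y ρ∼y)))
    where
    member : ∀ s → s ≢ just false → s ∈ Σ₀̄
    member ⋆            _ = there (here refl)
    member (just true)  _ = here refl
    member (just false) s≢ = contradiction refl s≢
  C-min≤ x fx≡⋆ true ρ ρ∼x avoids =
    ℕ.≤-trans (ℕ.m⊓n≤n _ _) (C-at≤ Σ₁̄ f x _ {ρ} (ρ∼x , λ y ρ∼y → member (f y) (avoids y ρ∼y)))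
    where
    member : ∀ s → s ≢ just true → s ∈ Σ₁̄
    member ⋆            _ = there (here refl)
    member (just false) _ = here refl
    member (just true)  s≢ = contradiction refl s≢

  certificate≥ : SmallCertificates →
    ∀ x (fx≡⋆ : f x ≡ ⋆) ρ → IsCertificate Σ₀ (toPartial g) (uniform x) ρ →
    C-min x fx≡⋆ ≤ ∣ ρ ∣
  certificate≥ small x fx≡⋆ ρ (ρ∼z , cert) = ℕ.≮⇒≥ impossible
    where
    ρ∼x : ∀ i → Consistent (copyᵖ ρ i) x
    ρ∼x i j set =
      let e = lookup-copyᵖ ρ i j
      in trans e (trans (ρ∼z _ (set ∘ trans e)) (cong just (value-assemble (uniformValue x) (inj₁ (i , j)))))

    realise : ∣ ρ ∣ < C-min x fx≡⋆ → ∀ i b → ∃[ y ] Consistent (copyᵖ ρ i) y × f y ≡ just b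
    realise small i b with any-by (inputs _) ∈-inputs
      (λ y → consistent? (copyᵖ ρ i) y ×-dec (f y ≟ˢ just b))
    ... | yes found = found
    -- Without a completion of value `b`, the part of `ρ` on copy `i` excludes `b`, so `ρ` is too
    -- large.
    ... | no ¬found = contradiction
      (ℕ.≤-trans (C-min≤ x fx≡⋆ b (copyᵖ ρ i) (ρ∼x i) λ y c e → ¬found (y , c , e)) (∣copyᵖ∣≤ ρ i))
      (ℕ.<⇒≱ small)

    Touched : Fin (2 ^ m) → Set
    Touched a = ∃[ r ] lookup ρ (position (inj₂ (a , Inverse.to cell↔ r))) ≢ ⋆

    touched? : ∀ a → Dec (Touched a)
    touched? a = Fin.any? λ r → ¬? (lookup ρ (position (inj₂ (a , Inverse.to cell↔ r))) ≟ˢ ⋆)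

    all-touched : (∀ a → Touched a) → C-min x fx≡⋆ ≤ ∣ ρ ∣
    all-touched touched = begin
      C-min x fx≡⋆                    ≤⟨ ℕ.m⊓n≤m _ _ ⟩
      C-at Σ₀̄ f x (there (here fx≡⋆)) ≤⟨ C-at≤n Σ₀̄ f x _ ⟩
      -- There are as many cells as input bits of `f`, and choosing a set bit in each cell is
      -- injective because cells are disjoint.
      2 ^ m                           ≤⟨ set-injectively φ inj ρ (λ a → proj₂ (touched a)) ⟩
      ∣ ρ ∣                           ∎
      where
      open ℕ.≤-Reasoning
      φ : Fin (2 ^ m) → Fin arity
      φ a = position (inj₂ (a , Inverse.to cell↔ (proj₁ (touched a))))
      inj : Injective _≡_ _≡_ φ
      inj {a} {a′} e =
        cong proj₁ (inj₂-injective (position-injective {inj₂ (a , _)} {inj₂ (a′ , _)} e))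

    untouched : ∣ ρ ∣ < C-min x fx≡⋆ → ∃[ a ] Untouched ρ a
    untouched ∣ρ∣< with a , ¬touched ← Fin.¬∀⟶∃¬ _ Touched touched? (λ t → ℕ.<⇒≱ ∣ρ∣< (all-touched t))
      = a , λ s → decidable-stable (_ ≟ˢ ⋆) λ set → ¬touched
          (Inverse.from cell↔ s ,
           subst (λ s → lookup ρ (position (inj₂ (a , s))) ≢ ⋆) (sym (Inverse.strictlyInverseˡ cell↔ s)) set)

    impossible : ¬ (∣ ρ ∣ < C-min x fx≡⋆)
    impossible ∣ρ∣< =
      let a , u = untouched ∣ρ∣<
          -- Copy `i` is completed so that its value is bit `i` of the untouched address.
          y i = realise ∣ρ∣< i (lookup (toBits m a) i)
          -- The all-zero address is the default pointer target.
          p i = certifiedBy small (fromBits (replicate m false)) (proj₂ (proj₂ (y i)))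
          z , ρ∼ , gz = forge x ρ a ρ∼z u (proj₁ ∘ y) (λ i → proj₁ (proj₂ (y i)))
                          (proj₁ ∘ p) (λ i → proj₂ (p i))
      in contradict {g z} gz (cert z ρ∼)
      where
      contradict : ∀ {b} → b ≡ true → ¬ (just b ∈ Σ₀)
      contradict refl (here ())
      contradict refl (there ())

  C₀-g≥ : SmallCertificates →
    Fin m → ∀ x (fx≡⋆ : f x ≡ ⋆) →
    C-min x fx≡⋆ ≤ C[ Σ₀ ] (toPartial g)
  C₀-g≥ small i x fx≡⋆ =
    let ρ , cert , ∣ρ∣≤C =
          certificate≤C[] Σ₀ (toPartial g) (uniform x) (here (cong just (g-uniform i x fx≡⋆)))
    in ℕ.≤-trans (certificate≥ small x fx≡⋆ ρ cert) ∣ρ∣≤C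

-- Arithmetic of the bounds

module _ where
  open ℕ.≤-Reasoning
  open +-*-Solver

  arity-bound : ∀ m n c .{{_ : NonZero m}} .{{_ : NonZero n}} → c ≤ n →
                m * n + n * (m * (c * m)) ≤ 3 * n ^ 2 * m ^ 2
  arity-bound m n c c≤n = begin
    m * n + n * (m * (c * m))
      ≤⟨ ℕ.+-mono-≤ (ℕ.*-mono-≤ (ℕ.m≤m*n m m) (ℕ.m≤m*n n n))
                    (ℕ.*-monoʳ-≤ n (ℕ.*-monoʳ-≤ m (ℕ.*-monoˡ-≤ m c≤n))) ⟩
    (m * m) * (n * n) + n * (m * (n * m))
      -- Both summands now equal `n ^ 2 * m ^ 2`; a third one is slack to reach the constant 3.
      ≤⟨ ℕ.m≤m+n _ (n ^ 2 * m ^ 2) ⟩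
    (m * m) * (n * n) + n * (m * (n * m)) + n ^ 2 * m ^ 2
      ≡⟨ solve 2 (λ m n → (m :* m) :* (n :* n) :+ n :* (m :* (n :* m)) :+ n :^ 2 :* m :^ 2
                       := con 3 :* n :^ 2 :* m :^ 2) refl m n ⟩
    3 * n ^ 2 * m ^ 2 ∎

  width-bound : ∀ m c .{{_ : NonZero m}} → m * (c * m) + m * c ≤ 3 * c * m ^ 2
  width-bound m c = begin
    m * (c * m) + m * c
      ≤⟨ ℕ.+-monoʳ-≤ (m * (c * m)) (ℕ.*-monoʳ-≤ m (ℕ.m≤m*n c m)) ⟩
    m * (c * m) + m * (c * m)
      ≤⟨ ℕ.m≤m+n _ (m * (c * m)) ⟩
    m * (c * m) + m * (c * m) + m * (c * m)
      ≡⟨ solve 2 (λ m c → m :* (c :* m) :+ m :* (c :* m) :+ m :* (c :* m)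
                       := con 3 :* c :* m :^ 2) refl m c ⟩
    3 * c * m ^ 2 ∎

-- Instantiation with `k = C f`

module _ (f : PartialFn n) where

  C≤n : C f ≤ n
  C≤n = ℕ.⊔-lub (C[]≤n Σ₀ f) (C[]≤n Σ₁ f)

  certificate≤C : ∀ {y b} → f y ≡ just b → ∃[ ρ ] IsCertificate (just b ∷ []) f y ρ × ∣ ρ ∣ ≤ C f
  certificate≤C {y} {false} fy =
    let ρ , cert , ∣ρ∣≤ = certificate≤C[] Σ₀ f y (here fy)
    in ρ , cert , ℕ.≤-trans ∣ρ∣≤ (ℕ.m≤m⊔n _ _)
  certificate≤C {y} {true} fy =
    let ρ , cert , ∣ρ∣≤ = certificate≤C[] Σ₁ f y (here fy)
    in ρ , cert , ℕ.≤-trans ∣ρ∣≤ (ℕ.m≤n⊔m (C[ Σ₀ ] f) _)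

theorem2p2 : (n : ℕ) → 2 ≤ n → (∃[ m ] n ≡ 2 ^ m) →
    (f : PartialFn n) (x : Input n) (fx≡⋆ : f x ≡ ⋆) →
    ∃[ N ] Σ[ g ∈ TotalFn N ]
    N ≤ 3 * n ^ 2 * ⌊log₂ n ⌋ ^ 2
    × C[ Σ₀ ] (toPartial g) ≥ C-at Σ₀̄ f x (there (here fx≡⋆)) ⊓ C-at Σ₁̄ f x (there (here fx≡⋆))
    × UC₁ g ≤ 3 * C f * ⌊log₂ n ⌋ ^ 2
-- Here `n = 1`, excluded by `2 ≤ n`; a positive `m` supplies the copy `zero` needed below.
theorem2p2 _ 2≤1 (zero , refl) = contradiction 2≤1 λ { (s≤s ()) }
theorem2p2 _ _ (m@(suc _) , refl) f x fx≡⋆ rewrite ⌊log₂[2^n]⌋≡n m =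
  arity , g , arity-bound m (2 ^ m) (C f) {{_}} {{ℕ.m^n≢0 2 m}} (C≤n f) ,
  C₀-g≥ (certificate≤C f) zero x fx≡⋆ , ℕ.≤-trans UC₁-g≤ (width-bound m (C f))
  where open CheatSheet m (C f) f
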